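{- Let $p$ be a prime, let $K \ge 1$, $n \ge 1$ and $j$ be integers with $0 \le j \le n-1$ and $p^{n-j} \ge Kp^{j}$ (equivalently, $2(n-j) \ge \log_p(K)+n$), and let $N = Kp^n+1$. Assume that there exist integers $a>1$ and $L$ such that: (i) $a^{Kp^{n-j-1}} \equiv L \pmod N$ and $L \not\equiv 1 \pmod N$, and (ii) $L^{p^{j+1}} \equiv 1 \pmod N$. Then $N$ is prime. -}

module Defs where

open import Data.Nat.Base using (ℕ)
open import Data.Integer.Base using (ℤ; +_; _-_)
open import Data.Integer.Divisibility.Signed using (_∣_)
open import Relation.Nullary.Negation.Core using (¬_)

infix 4 _≡_[mod_] _≢_[mod_]

_≡_[mod_] : ℤ → ℤ → ℕ → Set
x ≡ y [mod N ] = + N ∣ x - y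

_≢_[mod_] : ℤ → ℤ → ℕ → Set
x ≢ y [mod N ] = ¬ (x ≡ y [mod N ])

{-# OPTIONS --safe #-}

-- Put b = a^(K p^(n-j-1)), so b ≢ 1 and b^(p^(j+1)) ≡ 1 modulo N.  The number
-- p^(j+1) is coprime to N, which yields a prime q ∣ N with b ≢ 1 modulo q.  As
-- a^gcd(q-1, K p^n) ≡ 1 modulo q but a^(K p^(n-j-1)) ≢ 1, the power p^(n-j)
-- divides q - 1.  Both q and its cofactor r in N are thus 1 modulo D = p^(n-j),
-- and r > 1 would give N ≥ (1 + D)² > 1 + D² ≥ 1 + K p^n = N.
module Submission where

open import Defs
open import Data.Nat.Base using (ℕ; _+_; _*_; _∸_; _^_; _≤_; _≥_)
open import Data.Nat.Primality using (Prime)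
open import Data.Integer.Base as ℤ using (ℤ; 1ℤ)
open import Data.Product.Base using (∃-syntax; _×_)

open import Data.Nat.Base using (zero; suc; _<_; _!; z≤n; s≤s; NonZero; pred; >-nonZero; ≢-nonZero; ≢-nonZero⁻¹)
open import Data.Nat.Properties as ℕ using (_≟_)
open import Data.Nat.Divisibility as ℕ∣ using (_∣_; divides; _∣?_)
open import Data.Nat.Coprimality using (Coprime; coprime-divisor; gcd≡1⇒coprime)
open import Data.Nat.GCD using (gcd; gcd[m,n]∣m; gcd[m,n]∣n; gcd[m,n]≢0; gcd-GCD; module Bézout)
open import Data.Nat.Primality using
  (euclidsLemma; prime⇒nonZero; ¬prime[0]; ¬prime[1])
open import Data.Nat.Primality.Factorisation using (factorise)
open import Data.Nat.Combinatorics using (_C_; nCk≡n!/k![n-k]!; k![n∸k]!∣n!; nCn≡1)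
open import Data.Nat.DivMod using (m/n*n≡m)
open import Data.Nat.Tactic.RingSolver using () renaming (solve-∀ to solveℕ)
open import Algebra.Properties.CommutativeSemiring.Binomial ℕ.+-*-commutativeSemiring
  using (binomialTerm) renaming (theorem to binomialTheorem)
open import Algebra.Properties.Semiring.Sum ℕ.+-*-semiring using (sum; sum-init-last)
open import Algebra.Properties.Semiring.Exp ℕ.+-*-semiring using () renaming (_^_ to _^ᴱ_)
open import Algebra.Properties.Semiring.Mult ℕ.+-*-semiring using () renaming (_×_ to _×ᴹ_)
open import Data.Fin.Base using (Fin; toℕ; fromℕ; inject₁) renaming (zero to fzero; suc to fsuc)
open import Data.Fin.Properties using (toℕ-inject₁; toℕ-fromℕ; toℕ<n)
open import Data.Integer.Base using (+_; ∣_∣)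
import Data.Integer.Properties as ℤ
open import Data.Integer.Divisibility.Signed as ℤ∣ using (∣ᵤ⇒∣; ∣⇒∣ᵤ)
open import Data.Integer.Tactic.RingSolver using (solve-∀)
open import Data.List.Base using ([]; _∷_)
open import Data.List.Relation.Unary.All using (_∷_)
open import Data.Product.Base using (_,_)
open import Data.Sum.Base using (inj₁; inj₂)
open import Data.Empty using (⊥-elim)
open import Function.Base using (_∘_)
open import Relation.Nullary using (¬_; yes; no)
open import Relation.Binary.PropositionalEquality using
  (_≡_; _≢_; refl; sym; trans; cong; cong₂; subst; module ≡-Reasoning)

-- Congruences

module _ {N : ℕ} where

  mod-refl : ∀ x → x ≡ x [mod N ]
  mod-refl x = subst (+ N ℤ∣.∣_) (sym (ℤ.+-inverseʳ x)) (ℤ∣.divides (+ 0) refl)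

  mod-reflexive : ∀ {x y} → x ≡ y → x ≡ y [mod N ]
  mod-reflexive {x} refl = mod-refl x

  mod-sym : ∀ x y → x ≡ y [mod N ] → y ≡ x [mod N ]
  mod-sym x y d = subst (+ N ℤ∣.∣_) (lem x y) (ℤ∣.∣m⇒∣-m d)
    where
    lem : ∀ x y → ℤ.- (x ℤ.- y) ≡ y ℤ.- x
    lem = solve-∀

  mod-trans : ∀ x y z → x ≡ y [mod N ] → y ≡ z [mod N ] → x ≡ z [mod N ]
  mod-trans x y z d e = subst (+ N ℤ∣.∣_) (lem x y z) (ℤ∣.∣m∣n⇒∣m+n d e)
    where
    lem : ∀ x y z → (x ℤ.- y) ℤ.+ (y ℤ.- z) ≡ x ℤ.- z
    lem = solve-∀

  +-cong-mod : ∀ x y u v → x ≡ y [mod N ] → u ≡ v [mod N ] → x ℤ.+ u ≡ y ℤ.+ v [mod N ]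
  +-cong-mod x y u v d e = subst (+ N ℤ∣.∣_) (lem x y u v) (ℤ∣.∣m∣n⇒∣m+n d e)
    where
    lem : ∀ x y u v → (x ℤ.- y) ℤ.+ (u ℤ.- v) ≡ (x ℤ.+ u) ℤ.- (y ℤ.+ v)
    lem = solve-∀

  *-cong-mod : ∀ x y u v → x ≡ y [mod N ] → u ≡ v [mod N ] → x ℤ.* u ≡ y ℤ.* v [mod N ]
  *-cong-mod x y u v d e =
    subst (+ N ℤ∣.∣_) (lem x y u v) (ℤ∣.∣m∣n⇒∣m+n (ℤ∣.∣m⇒∣m*n u d) (ℤ∣.∣n⇒∣m*n y e))
    where
    lem : ∀ x y u v → (x ℤ.- y) ℤ.* u ℤ.+ y ℤ.* (u ℤ.- v) ≡ x ℤ.* u ℤ.- y ℤ.* v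
    lem = solve-∀

  ^-cong-mod : ∀ x y m → x ≡ y [mod N ] → x ℤ.^ m ≡ y ℤ.^ m [mod N ]
  ^-cong-mod x y zero    d = mod-refl 1ℤ
  ^-cong-mod x y (suc m) d = *-cong-mod x y (x ℤ.^ m) (y ℤ.^ m) d (^-cong-mod x y m d)

  x^m≡1∧m∣n⇒x^n≡1 : ∀ x {m n} → x ℤ.^ m ≡ 1ℤ [mod N ] → m ∣ n → x ℤ.^ n ≡ 1ℤ [mod N ]
  x^m≡1∧m∣n⇒x^n≡1 x {m} h (divides c refl) =
    mod-trans (x ℤ.^ (c * m)) ((x ℤ.^ m) ℤ.^ c) 1ℤ
      (mod-reflexive (trans (cong (x ℤ.^_) (ℕ.*-comm c m)) (sym (ℤ.^-*-assoc x m c))))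
      (mod-trans ((x ℤ.^ m) ℤ.^ c) (1ℤ ℤ.^ c) 1ℤ
        (^-cong-mod (x ℤ.^ m) 1ℤ c h) (mod-reflexive (ℤ.^-zeroˡ c)))

  -- Cancellation without inverses: multiplying by `x ^ m` does not change the residue of `x ^ d`,
  -- which is therefore that of `x ^ (d + m)`.
  x^[d+m]≡x^m≡1⇒x^d≡1 : ∀ x d m → x ℤ.^ (d + m) ≡ 1ℤ [mod N ] →
                        x ℤ.^ m ≡ 1ℤ [mod N ] → x ℤ.^ d ≡ 1ℤ [mod N ]
  x^[d+m]≡x^m≡1⇒x^d≡1 x d m h k =
    mod-trans xᵈ (x ℤ.^ (d + m)) 1ℤ
      (mod-sym (x ℤ.^ (d + m)) xᵈ
        (mod-trans (x ℤ.^ (d + m)) (xᵈ ℤ.* 1ℤ) xᵈ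
          (mod-trans (x ℤ.^ (d + m)) (xᵈ ℤ.* x ℤ.^ m) (xᵈ ℤ.* 1ℤ)
            (mod-reflexive (ℤ.^-distribˡ-+-* x d m))
            (*-cong-mod xᵈ xᵈ (x ℤ.^ m) 1ℤ (mod-refl xᵈ) k))
          (mod-reflexive (ℤ.*-identityʳ xᵈ))))
      h
    where xᵈ = x ℤ.^ d

  -- Bézout over ℕ makes the gcd plus a multiple of one exponent equal to a multiple of the other,
  -- so no negative power of `x` arises.
  x^gcd≡1 : ∀ x m n → x ℤ.^ m ≡ 1ℤ [mod N ] → x ℤ.^ n ≡ 1ℤ [mod N ] →
            x ℤ.^ gcd m n ≡ 1ℤ [mod N ]
  x^gcd≡1 x m n h k with Bézout.identity (gcd-GCD m n)
  ... | Bézout.Identity.+- u v eq = x^[d+m]≡x^m≡1⇒x^d≡1 x (gcd m n) (v * n)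
    (x^m≡1∧m∣n⇒x^n≡1 x h (divides u eq)) (x^m≡1∧m∣n⇒x^n≡1 x k (divides v refl))
  ... | Bézout.Identity.-+ u v eq = x^[d+m]≡x^m≡1⇒x^d≡1 x (gcd m n) (u * m)
    (x^m≡1∧m∣n⇒x^n≡1 x k (divides v eq)) (x^m≡1∧m∣n⇒x^n≡1 x h (divides u refl))

mod-coarsen : ∀ {q N} x y → q ∣ N → x ≡ y [mod N ] → x ≡ y [mod q ]
mod-coarsen x y q∣N = ℤ∣.∣-trans (∣ᵤ⇒∣ q∣N)

pos-^ : ∀ x m → + (x ^ m) ≡ (+ x) ℤ.^ m
pos-^ x zero    = refl
pos-^ x (suc m) = trans (ℤ.pos-* x (x ^ m)) (cong (+ x ℤ.*_) (pos-^ x m))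

-- Fermat's little theorem

p∤k! : ∀ {p} → Prime p → ∀ k → k < p → ¬ p ∣ k !
p∤k! pp zero    k<p p∣1 = ¬prime[1] (subst Prime (ℕ∣.∣1⇒≡1 p∣1) pp)
p∤k! pp (suc k) k<p p∣k! with euclidsLemma (suc k) (k !) pp p∣k!
... | inj₁ p∣1+k = ℕ∣.>⇒∤ k<p p∣1+k
... | inj₂ p∣k!′ = p∤k! pp k (ℕ.<-trans (ℕ.n<1+n k) k<p) p∣k!′

p∣p! : ∀ {p} → Prime p → p ∣ p !
p∣p! {zero}  pp = ⊥-elim (¬prime[0] pp)
p∣p! {suc p} pp = ℕ∣.m∣m*n (p !)

-- `p` divides `p !`, which is `p C k` times two factorials; since `k` and `p ∸ k` are both below
-- `p`, it divides neither factorial.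
p∣pCk : ∀ {p} → Prime p → ∀ k → 0 < k → k < p → p ∣ (p C k)
p∣pCk {p} pp k 0<k k<p
  with euclidsLemma (p C k) (k ! * (p ∸ k) !) pp (subst (p ∣_) (sym p!) (p∣p! pp))
  where
  k≤p = ℕ.<⇒≤ k<p
  p! : (p C k) * (k ! * (p ∸ k) !) ≡ p !
  p! = trans (cong (_* (k ! * (p ∸ k) !)) (nCk≡n!/k![n-k]! k≤p))
             (m/n*n≡m {{ℕ._!*_!≢0 k (p ∸ k)}} (k![n∸k]!∣n! k≤p))
... | inj₁ d = d
... | inj₂ d with euclidsLemma (k !) ((p ∸ k) !) pp d
...   | inj₁ d′ = ⊥-elim (p∤k! pp k k<p d′)
...   | inj₂ d′ = ⊥-elim (p∤k! pp (p ∸ k) (ℕ.∸-monoʳ-< 0<k (ℕ.<⇒≤ k<p)) d′)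

∣-sum : ∀ {d n} (f : Fin n → ℕ) → (∀ i → d ∣ f i) → d ∣ sum f
∣-sum {n = zero}  f h = divides 0 refl
∣-sum {n = suc n} f h = ℕ∣.∣m∣n⇒∣m+n (h fzero) (∣-sum (f ∘ fsuc) (h ∘ fsuc))

-- The binomial theorem used below lives over an abstract semiring, with its own multiples and
-- powers; this lemma and the next identify them with arithmetic on ℕ.
×ᴹ≡* : ∀ m n → m ×ᴹ n ≡ m * n
×ᴹ≡* zero    n = refl
×ᴹ≡* (suc m) n = cong (λ k → n + k) (×ᴹ≡* m n)

^ᴱ≡^ : ∀ m n → m ^ᴱ n ≡ m ^ n
^ᴱ≡^ m zero    = refl
^ᴱ≡^ m (suc n) = cong (m *_) (^ᴱ≡^ m n)

binomialTerm-1 : ∀ x n k → binomialTerm x 1 n k ≡ (n C toℕ k) * x ^ toℕ k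
binomialTerm-1 x n k = begin
  binomialTerm x 1 n k                               ≡⟨ ×ᴹ≡* (n C toℕ k) _ ⟩
  (n C toℕ k) * (x ^ᴱ toℕ k * 1 ^ᴱ (n ∸ toℕ k))       ≡⟨ cong ((n C toℕ k) *_)
    (cong₂ _*_ (^ᴱ≡^ x (toℕ k)) (trans (^ᴱ≡^ 1 (n ∸ toℕ k)) (ℕ.^-zeroˡ (n ∸ toℕ k)))) ⟩
  (n C toℕ k) * (x ^ toℕ k * 1)                      ≡⟨ cong ((n C toℕ k) *_) (ℕ.*-identityʳ (x ^ toℕ k)) ⟩
  (n C toℕ k) * x ^ toℕ k                            ∎
  where open ≡-Reasoning

-- The extreme terms of the binomial expansion are 1 and `x ^ p`; `s` gathers the others, whose
-- coefficients are all divisible by `p`.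
[x+1]^p : ∀ {p} → Prime p → ∀ x → ∃[ s ] (p ∣ s × (x + 1) ^ p ≡ 1 + (s + x ^ p))
[x+1]^p {zero}  pp x = ⊥-elim (¬prime[0] pp)
[x+1]^p {suc r} pp x = sum mid , ∣-sum mid p∣mid , (begin
  (x + 1) ^ suc r                     ≡⟨ ^ᴱ≡^ (x + 1) (suc r) ⟨
  (x + 1) ^ᴱ suc r                    ≡⟨ binomialTheorem (suc r) x 1 ⟩
  t fzero + sum (t ∘ fsuc)            ≡⟨ cong₂ _+_ first (sum-init-last (t ∘ fsuc)) ⟩
  1 + (sum mid + t (fsuc (fromℕ r)))  ≡⟨ cong (λ z → 1 + (sum mid + z)) lst ⟩
  1 + (sum mid + x ^ suc r)           ∎)
  where
  open ≡-Reasoning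
  t : Fin (suc (suc r)) → ℕ
  t = binomialTerm x 1 (suc r)
  -- `inject₁` omits the last index and `fsuc` the first, leaving the exponents 1 to `r`, strictly
  -- between 0 and `suc r`.
  mid : Fin r → ℕ
  mid i = t (fsuc (inject₁ i))
  first : t fzero ≡ 1
  first = binomialTerm-1 x (suc r) fzero
  lst : t (fsuc (fromℕ r)) ≡ x ^ suc r
  lst = trans (binomialTerm-1 x (suc r) (fsuc (fromℕ r)))
    (trans (cong (λ k → (suc r C suc k) * x ^ suc k) (toℕ-fromℕ r))
    (trans (cong (_* x ^ suc r) (nCn≡1 (suc r))) (ℕ.*-identityˡ _)))
  p∣mid : ∀ i → suc r ∣ mid i
  p∣mid i = subst (suc r ∣_) (sym (binomialTerm-1 x (suc r) (fsuc (inject₁ i))))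
    (ℕ∣.∣m⇒∣m*n _ (p∣pCk pp (suc (toℕ (inject₁ i))) (s≤s z≤n)
      (s≤s (subst (_< r) (sym (toℕ-inject₁ i)) (toℕ<n i)))))

-- Induction on `x`: modulo `p` the middle sum `s` vanishes, so raising to the power `p` commutes
-- with adding 1.
fermat : ∀ {p} → Prime p → ∀ x → (+ x) ℤ.^ p ≡ + x [mod p ]
fermat {zero}  pp x = ⊥-elim (¬prime[0] pp)
fermat {suc r} pp zero = mod-refl (+ 0)
fermat {p@(suc r)} pp (suc x) with [x+1]^p pp x
... | s , p∣s , eq = subst (λ z → z ≡ + suc x [mod p ]) (sym pow)
    (+-cong-mod 1ℤ 1ℤ (+ (s + x ^ p)) (+ x) (mod-refl 1ℤ)
      (+-cong-mod (+ s) (+ 0) (+ (x ^ p)) (+ x) s≡0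
        (subst (λ z → z ≡ + x [mod p ]) (sym (pos-^ x p)) (fermat pp x))))
  where
  pow : (+ suc x) ℤ.^ p ≡ + (1 + (s + x ^ p))
  pow = trans (sym (pos-^ (suc x) p)) (cong +_ (trans (cong (_^ p) (ℕ.+-comm 1 x)) eq))
  s≡0 : + s ≡ + 0 [mod p ]
  s≡0 = subst (+ p ℤ∣.∣_) (sym (ℤ.+-identityʳ (+ s))) (∣ᵤ⇒∣ p∣s)

-- A unit is recognised by having some positive power congruent to 1.
fermat-unit : ∀ {q} → Prime q → ∀ x m → .{{NonZero m}} →
              (+ x) ℤ.^ m ≡ 1ℤ [mod q ] → (+ x) ℤ.^ pred q ≡ 1ℤ [mod q ]
fermat-unit {zero}      qp x m       h = ⊥-elim (¬prime[0] qp)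
-- As `r + suc m` equals `q + m`, Fermat replaces the factor `X ^ q` by `X`; the result `X ^ suc m`
-- is 1, and cancelling it leaves `X ^ r`.
fermat-unit {q@(suc r)} qp x (suc m) h = x^[d+m]≡x^m≡1⇒x^d≡1 X r (suc m)
    (mod-trans (X ℤ.^ (r + suc m)) (X ℤ.^ suc m) 1ℤ
      (subst (λ z → z ≡ X ℤ.^ suc m [mod q ])
        (trans (sym (ℤ.^-distribˡ-+-* X q m)) (cong (X ℤ.^_) (sym (ℕ.+-suc r m))))
        (*-cong-mod (X ℤ.^ q) X (X ℤ.^ m) (X ℤ.^ m) (fermat qp x) (mod-refl (X ℤ.^ m))))
      h)
    h
  where X = + x

-- A prime divisor separating b from 1

-- The sum 1 + x + ⋯ + x^(m-1) in Horner form.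
geometric : ℤ → ℕ → ℤ
geometric x zero    = + 0
geometric x (suc m) = 1ℤ ℤ.+ x ℤ.* geometric x m

geometric-telescopes : ∀ x m → geometric x m ℤ.* (x ℤ.- 1ℤ) ≡ x ℤ.^ m ℤ.- 1ℤ
geometric-telescopes x zero    = refl
geometric-telescopes x (suc m) = begin
  (1ℤ ℤ.+ x ℤ.* g) ℤ.* (x ℤ.- 1ℤ)              ≡⟨ expand x g ⟩
  x ℤ.* (g ℤ.* (x ℤ.- 1ℤ)) ℤ.+ (x ℤ.- 1ℤ)      ≡⟨ cong (λ z → x ℤ.* z ℤ.+ (x ℤ.- 1ℤ)) (geometric-telescopes x m) ⟩
  x ℤ.* (x ℤ.^ m ℤ.- 1ℤ) ℤ.+ (x ℤ.- 1ℤ)        ≡⟨ collect x (x ℤ.^ m) ⟩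
  x ℤ.* x ℤ.^ m ℤ.- 1ℤ                         ∎
  where
  open ≡-Reasoning
  g = geometric x m
  expand : ∀ x g → (1ℤ ℤ.+ x ℤ.* g) ℤ.* (x ℤ.- 1ℤ) ≡ x ℤ.* (g ℤ.* (x ℤ.- 1ℤ)) ℤ.+ (x ℤ.- 1ℤ)
  expand = solve-∀
  collect : ∀ x y → x ℤ.* (y ℤ.- 1ℤ) ℤ.+ (x ℤ.- 1ℤ) ≡ x ℤ.* y ℤ.- 1ℤ
  collect = solve-∀

geometric-at-1 : ∀ {q} x m → x ≡ 1ℤ [mod q ] → geometric x m ≡ + m [mod q ]
geometric-at-1 x zero    h = mod-refl (+ 0)
geometric-at-1 x (suc m) h = +-cong-mod 1ℤ 1ℤ (x ℤ.* g) (+ m) (mod-refl 1ℤ)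
    (subst (λ z → x ℤ.* g ≡ z [mod _ ]) (ℤ.*-identityˡ (+ m))
      (*-cong-mod x 1ℤ g (+ m) h (geometric-at-1 x m h)))
  where g = geometric x m

∃-prime-divisor : ∀ n → .{{NonZero n}} → n ≢ 1 → ∃[ q ] (Prime q × q ∣ n)
∃-prime-divisor n n≢1 with factorise n
... | record { factors = []     ; isFactorisation = eq } = ⊥-elim (n≢1 eq)
... | record { factors = q ∷ qs ; isFactorisation = eq ; factorsPrime = qp ∷ _ } =
  q , qp , subst (q ∣_) (sym eq) (ℕ∣.m∣m*n _)

-- N divides (b - 1)(1 + b + ⋯ + b^(m-1)) but not b - 1, so some prime q divides
-- both N and the sum; b ≡ 1 modulo q would make that sum ≡ m.
∃-prime-separating : ∀ {N} b m → .{{NonZero N}} → Coprime m N →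
                     b ℤ.^ m ≡ 1ℤ [mod N ] → b ≢ 1ℤ [mod N ] →
                     ∃[ q ] (Prime q × q ∣ N × b ≢ 1ℤ [mod q ])
∃-prime-separating {N} b m cop bᵐ≡1 b≢1 with gcd N ∣ geometric b m ∣ ≟ 1
... | yes g≡1 = ⊥-elim (b≢1 (∣ᵤ⇒∣ (coprime-divisor (gcd≡1⇒coprime g≡1)
    (subst (N ∣_) (ℤ.abs-* S (b ℤ.- 1ℤ))
      (∣⇒∣ᵤ (subst (+ N ℤ∣.∣_) (sym (geometric-telescopes b m)) bᵐ≡1))))))
  where S = geometric b m
... | no g≢1 with ∃-prime-divisor (gcd N ∣ geometric b m ∣)
                    {{≢-nonZero (gcd[m,n]≢0 N _ (inj₁ (≢-nonZero⁻¹ N)))}} g≢1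
...   | q , qp , q∣g = q , qp , q∣N , λ b≡1 → q≢1 (cop (q∣m b≡1 , q∣N))
  where
  S = geometric b m
  q∣N : q ∣ N
  q∣N = ℕ∣.∣-trans q∣g (gcd[m,n]∣m N _)
  q∣S : + q ℤ∣.∣ S
  q∣S = ∣ᵤ⇒∣ (ℕ∣.∣-trans q∣g (gcd[m,n]∣n N ∣ S ∣))
  cancel : ∀ s k → s ℤ.- (s ℤ.- k) ≡ k
  cancel = solve-∀
  q∣m : b ≡ 1ℤ [mod q ] → q ∣ m
  q∣m b≡1 = ∣⇒∣ᵤ (subst (+ q ℤ∣.∣_) (cancel S (+ m))
    (ℤ∣.∣m∣n⇒∣m-n q∣S (geometric-at-1 b m b≡1)))
  q≢1 : q ≢ 1
  q≢1 refl = ¬prime[1] qp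

-- Prime powers

-- Euclid's lemma places one factor `p` in `g`; cancelling it from both sides leaves the same claim
-- for `n` and the quotient `h`.
p^n∣cg⇒p^n∣g : ∀ {p} → Prime p → ∀ n {c g} → ¬ p ∣ c → p ^ n ∣ c * g → p ^ n ∣ g
p^n∣cg⇒p^n∣g pp zero    p∤c d = ℕ∣.1∣ _
p^n∣cg⇒p^n∣g {p} pp (suc n) {c} {g} p∤c d
  with euclidsLemma c g pp (ℕ∣.∣-trans (ℕ∣.m∣m*n (p ^ n)) d)
... | inj₁ p∣c = ⊥-elim (p∤c p∣c)
... | inj₂ (divides h refl) = subst (p ^ suc n ∣_) (ℕ.*-comm p h)
  (ℕ∣.*-monoʳ-∣ p (p^n∣cg⇒p^n∣g pp n p∤c
    (ℕ∣.*-cancelˡ-∣ p {{prime⇒nonZero pp}} (subst (p * p ^ n ∣_) (swap c h p) d))))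
  where
  swap : ∀ c h p → c * (h * p) ≡ p * (c * h)
  swap = solveℕ

-- Let `c` be the cofactor of `g`. If `p` divides `c`, one `p` cancels and `i` drops; otherwise the
-- whole power of `p` lies in `g`, which is too much. Nothing is assumed about `p` and `K`, which
-- may share factors.
g∣Kp^n⇒g∣Kp^k : ∀ {p} → Prime p → ∀ K k i {g} → ¬ p ^ suc k ∣ g →
                 g ∣ K * p ^ (i + k) → g ∣ K * p ^ k
g∣Kp^n⇒g∣Kp^k pp K k zero    p∤g d = d
g∣Kp^n⇒g∣Kp^k {p} pp K k (suc i) {g} p∤g (divides c eq) with p ∣? c
... | yes (divides c′ refl) = g∣Kp^n⇒g∣Kp^k pp K k i p∤g
    (divides c′ (ℕ.*-cancelˡ-≡ _ _ p {{prime⇒nonZero pp}}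
      (trans (swapˡ p K (p ^ (i + k))) (trans eq (swapʳ c′ p g)))))
  where
  swapˡ : ∀ p K y → p * (K * y) ≡ K * (p * y)
  swapˡ = solveℕ
  swapʳ : ∀ c p g → c * p * g ≡ p * (c * g)
  swapʳ = solveℕ
-- Here the exponent is `suc i + k`, at least `suc k`, so `p ^ suc k` would divide `g`.
... | no p∤c = ⊥-elim (p∤g (ℕ∣.∣-trans (divides (p ^ i)
    (trans (cong (p ^_) (sym (ℕ.+-suc i k))) (ℕ.^-distribˡ-+-* p i (suc k))))
    (p^n∣cg⇒p^n∣g pp (suc i + k) p∤c (subst (p ^ (suc i + k) ∣_) eq (ℕ∣.n∣m*n K)))))

-- Size of the cofactor and the primality criterion

-- With `r` = 1 + r′, expanding the product gives M = q′ + r′q′ + r′, so `D` divides r′ as well. If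
-- r′ is positive, both r′ and q′ are at least `D`, and `M` exceeds D².
cofactor≡1 : ∀ {D M q′} r → D ∣ suc q′ ∸ 1 → 0 < q′ → D ∣ M → M ≤ D * D →
             suc M ≡ r * suc q′ → r ≡ 1
cofactor≡1 zero          _    _    _   _    ()
cofactor≡1 (suc zero)    _    _    _   _    _  = refl
cofactor≡1 {D} {M} {q′} (suc r′@(suc _)) D∣q′ 0<q′ D∣M M≤DD eq = ⊥-elim (ℕ.<⇒≱ DD<M M≤DD)
  where
  M≡ : M ≡ q′ + (r′ * q′ + r′)
  M≡ = trans (ℕ.suc-injective eq) (cong (λ k → q′ + k) (trans (ℕ.*-suc r′ q′) (ℕ.+-comm r′ _)))
  D∣r′ : D ∣ r′
  D∣r′ = ℕ∣.∣m+n∣m⇒∣n (ℕ∣.∣m+n∣m⇒∣n (subst (D ∣_) M≡ D∣M) D∣q′) (ℕ∣.∣n⇒∣m*n r′ D∣q′)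
  DD<M : D * D < M
  DD<M = begin-strict
    D * D                ≤⟨ ℕ.*-mono-≤ (ℕ∣.∣⇒≤ D∣r′) (ℕ∣.∣⇒≤ {{>-nonZero 0<q′}} D∣q′) ⟩
    r′ * q′              <⟨ ℕ.m<m+n (r′ * q′) (s≤s z≤n) ⟩
    r′ * q′ + r′         ≤⟨ ℕ.m≤n+m _ q′ ⟩
    q′ + (r′ * q′ + r′)  ≡⟨ M≡ ⟨
    M                    ∎
    where open ℕ.≤-Reasoning

-- The gcd of `pred q` and the exponent stands in for the order of `a` modulo `q`. Were it not
-- divisible by `p ^ suc e`, it would divide `K * p ^ e` and force the excluded congruence.
p^1+e∣q-1 : ∀ {p q} → Prime p → Prime q → ∀ K e i a → K ≥ 1 →
            (+ a) ℤ.^ (K * p ^ (i + e)) ≡ 1ℤ [mod q ] →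
            (+ a) ℤ.^ (K * p ^ e) ≢ 1ℤ [mod q ] → p ^ suc e ∣ pred q
p^1+e∣q-1 {p} {q} pp qp K e i a K≥1 h k with p ^ suc e ∣? gcd (pred q) (K * p ^ (i + e))
... | yes d = ℕ∣.∣-trans d (gcd[m,n]∣m (pred q) _)
... | no ¬d = ⊥-elim (k (x^m≡1∧m∣n⇒x^n≡1 (+ a)
    (x^gcd≡1 (+ a) (pred q) M (fermat-unit qp a M {{M≢0}} h) h)
    (g∣Kp^n⇒g∣Kp^k pp K e i ¬d (gcd[m,n]∣n (pred q) M))))
  where
  M = K * p ^ (i + e)
  M≢0 : NonZero M
  M≢0 = ℕ.m*n≢0 K (p ^ (i + e)) {{>-nonZero K≥1}} {{ℕ.m^n≢0 p (i + e) {{prime⇒nonZero pp}}}}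

-- The criterion with n = j + 1 + e, which removes truncated subtraction: n - j becomes `suc e` and
-- n - j - 1 becomes `e`.
proth-like : ∀ {p} → Prime p → ∀ K e j a → K ≥ 1 → K * p ^ j ≤ p ^ suc e →
             let N = K * p ^ (suc j + e) + 1 ; b = (+ a) ℤ.^ (K * p ^ e) in
             b ≢ 1ℤ [mod N ] → b ℤ.^ (p ^ (j + 1)) ≡ 1ℤ [mod N ] → Prime N
proth-like {p} pp K e j a K≥1 Kpʲ≤D b≢1 bᵖ≡1 = conclude
    (∃-prime-separating b (p ^ (j + 1)) {{N≢0}} coprime bᵖ≡1 b≢1)
  where
  M N D : ℕ
  M = K * p ^ (suc j + e)
  N = M + 1
  D = p ^ suc e
  b = (+ a) ℤ.^ (K * p ^ e)
  1+M≡N : suc M ≡ N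
  1+M≡N = ℕ.+-comm 1 M
  N≢0 : NonZero N
  N≢0 = subst NonZero 1+M≡N _
  -- This factorisation serves twice: it shows that `D` divides `M`, and with `K * p ^ j` at most
  -- `D` it bounds `M` by D².
  M≡ : M ≡ K * p ^ j * D
  M≡ = trans (cong (λ i → K * p ^ i) (sym (ℕ.+-suc j e)))
    (trans (cong (K *_) (ℕ.^-distribˡ-+-* p j (suc e))) (sym (ℕ.*-assoc K (p ^ j) D)))
  exponent : K * p ^ e * p ^ (j + 1) ≡ M
  exponent = trans (ℕ.*-assoc K (p ^ e) _) (cong (K *_)
    (trans (sym (ℕ.^-distribˡ-+-* p e (j + 1))) (cong (p ^_) (rearrange e j))))
    where
    rearrange : ∀ e j → e + (j + 1) ≡ suc j + e
    rearrange = solveℕ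
  -- `p ^ (j + 1)` divides `M`, so a common divisor with `N` = `M + 1` divides 1.
  coprime : Coprime (p ^ (j + 1)) N
  coprime (d∣pʲ⁺¹ , d∣N) = ℕ∣.∣1⇒≡1 (ℕ∣.∣m+n∣m⇒∣n d∣N
    (ℕ∣.∣-trans d∣pʲ⁺¹ (divides (K * p ^ e) (sym exponent))))
  aᴹ≡1 : (+ a) ℤ.^ M ≡ 1ℤ [mod N ]
  aᴹ≡1 = subst (λ z → z ≡ 1ℤ [mod N ])
    (trans (ℤ.^-*-assoc (+ a) (K * p ^ e) (p ^ (j + 1))) (cong ((+ a) ℤ.^_) exponent)) bᵖ≡1
  conclude : ∃[ q ] (Prime q × q ∣ N × b ≢ 1ℤ [mod q ]) → Prime N
  conclude (zero , qp , _) = ⊥-elim (¬prime[0] qp)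
  conclude (suc zero , qp , _) = ⊥-elim (¬prime[1] qp)
  -- Exposing two successors makes `pred q` visibly positive, as the cofactor bound requires.
  conclude (q@(suc (suc _)) , qp , q∣N@(divides r N≡rq) , b≢1q) =
    subst Prime (sym (trans N≡rq (trans (cong (_* q) r≡1) (ℕ.*-identityˡ q)))) qp
    where
    r≡1 : r ≡ 1
    r≡1 = cofactor≡1 r
      (p^1+e∣q-1 pp qp K e (suc j) a K≥1
        (mod-coarsen ((+ a) ℤ.^ M) 1ℤ q∣N aᴹ≡1) b≢1q)
      (s≤s z≤n) (divides (K * p ^ j) M≡)
      (subst (_≤ D * D) (sym M≡) (ℕ.*-monoˡ-≤ D Kpʲ≤D))
      (trans 1+M≡N N≡rq)

theorem2p5 : (p K n j : ℕ) → Prime p → K ≥ 1 → n ≥ 1 → j ≤ n ∸ 1 →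
    p ^ (n ∸ j) ≥ K * p ^ j →
    let N = K * p ^ n + 1 in
    (∃[ a ] ∃[ L ] (a ℤ.> 1ℤ ×
    (a ℤ.^ (K * p ^ (n ∸ j ∸ 1)) ≡ L [mod N ] × L ≢ 1ℤ [mod N ]) ×
    L ℤ.^ (p ^ (j + 1)) ≡ 1ℤ [mod N ])) →
    Prime N
theorem2p5 p K (suc n) j pp K≥1 _ j≤n Kpʲ≤D (+ a , L , _ , (b≡L , L≢1) , Lᵖ≡1)
  with ℕ.m≤n⇒∃[o]m+o≡n j≤n
-- With `n` now `j + e` plus one, the rewrite turns `n ∸ j` into `suc e`, after which `n ∸ j ∸ 1`
-- computes to `e`.
... | e , refl rewrite trans (cong (_∸ j) (sym (ℕ.+-suc j e))) (ℕ.m+n∸m≡n j (suc e)) =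
  proth-like pp K e j a K≥1 Kpʲ≤D
    -- `L` is another representative of the residue of `b`, so both conditions on `L` pass to `b`.
    (λ b≡1 → L≢1 (mod-trans L b 1ℤ (mod-sym b L b≡L) b≡1))
    (mod-trans (b ℤ.^ m) (L ℤ.^ m) 1ℤ (^-cong-mod b L m b≡L) Lᵖ≡1)
  where
  b = (+ a) ℤ.^ (K * p ^ e)
  m = p ^ (j + 1)
theorem2p5 _ _ _ _ _ _ _ _ _ (ℤ.-[1+ _ ] , _ , () , _)
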